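{- Let $m \geq 4$ be an integer. Then $\alpha\left(W_{m,1}^{(2)}\right)=\left\lfloor \frac{m}{2}\left\lfloor \frac{m}{2}\right\rfloor \right\rfloor$.
   Context: Graphs are finite and simple. For a graph $G$, the double vertex graph $G^{(2)}$ is the graph whose vertices are all $2$-subsets of $V(G)$, where two $2$-subsets are adjacent whenever their symmetric difference is (the set of endpoints of) an edge of $G$. The wheel graph $W_{m,1}$ is the join $C_m+K_1$, where $C_m$ is the cycle with $m$ vertices and $K_1$ is the complete graph with one vertex (the join of two disjoint graphs adds all edges between them). $\alpha(G)$ denotes the independence number of $G$, i.e. the maximum cardinality of a set of pairwise non-adjacent vertices. -}

module Defs where

open import Data.Bool using (true; false)
open import Data.Fin using (Fin; toℕ; splitAt)
import Data.Fin.Subset as Subset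
open import Data.Fin.Subset using (Subset; ⁅_⁆; _∪_; _─_; ∣_∣)
open import Data.Fin.Subset.Properties using (∪-comm; ∉⊥; x∈⁅x⁆; p⊆p∪q)
open import Data.List using (List; length)
open import Data.List.Membership.Propositional using (_∈_)
open import Data.List.Relation.Unary.Unique.Propositional using (Unique)
open import Data.Nat using (ℕ; suc; _+_; _≤_)
open import Data.Product using (Σ-syntax; ∃-syntax; _×_; _,_)
open import Data.Sum using (_⊎_; inj₁; inj₂; swap)
open import Data.Unit using (⊤; tt)
open import Data.Vec using ([]; _∷_)
open import Relation.Nullary using (¬_)
open import Relation.Binary.PropositionalEquality
  using (_≡_; _≢_; refl; sym; trans; cong; subst; ≢-sym)

-- A simple graph on the vertex set V.  Finiteness is not a field: it comes
-- from the vertex types used below, `Fin n` and the 2-subsets of `Fin n`.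
record Graph (V : Set) : Set₁ where
  field
    _~_    : V → V → Set
    symm   : ∀ {u v} → u ~ v → v ~ u
    irrefl : ∀ {u} → ¬ (u ~ u)

open Graph

-- j = i + 1 (mod m)
Next : {m : ℕ} → Fin m → Fin m → Set
Next {m} i j = (toℕ j ≡ suc (toℕ i)) ⊎ (suc (toℕ i) ≡ m × toℕ j ≡ 0)

-- This is the m-cycle for m ≥ 3; the conjunct i ≢ j only matters for m = 1,
-- where it excludes a loop.
cycle : (m : ℕ) → Graph (Fin m)
cycle m ._~_ i j = i ≢ j × (Next i j ⊎ Next j i)
cycle m .symm (i≢j , e) = ≢-sym i≢j , swap e
cycle m .irrefl (i≢i , _) = i≢i refl

complete : (n : ℕ) → Graph (Fin n)
complete n ._~_ i j = i ≢ j
complete n .symm = ≢-sym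
complete n .irrefl i≢i = i≢i refl

module _ {m n : ℕ} (G : Graph (Fin m)) (H : Graph (Fin n)) where

  JoinAdj : Fin m ⊎ Fin n → Fin m ⊎ Fin n → Set
  JoinAdj (inj₁ u) (inj₁ v) = G ._~_ u v
  JoinAdj (inj₁ u) (inj₂ y) = ⊤
  JoinAdj (inj₂ x) (inj₁ v) = ⊤
  JoinAdj (inj₂ x) (inj₂ y) = H ._~_ x y

  JoinAdj-sym : ∀ s t → JoinAdj s t → JoinAdj t s
  JoinAdj-sym (inj₁ u) (inj₁ v) e = G .symm e
  JoinAdj-sym (inj₁ u) (inj₂ y) e = tt
  JoinAdj-sym (inj₂ x) (inj₁ v) e = tt
  JoinAdj-sym (inj₂ x) (inj₂ y) e = H .symm e

  JoinAdj-irrefl : ∀ s → ¬ JoinAdj s s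
  JoinAdj-irrefl (inj₁ u) e = G .irrefl e
  JoinAdj-irrefl (inj₂ x) e = H .irrefl e

  -- The disjoint union of the vertex sets is Fin (m + n): the first m elements
  -- are the vertices of G, the remaining n those of H.
  join : Graph (Fin (m + n))
  join ._~_ i j = JoinAdj (splitAt m i) (splitAt m j)
  join .symm {i} {j} = JoinAdj-sym (splitAt m i) (splitAt m j)
  join .irrefl {i} = JoinAdj-irrefl (splitAt m i)

wheel : (m : ℕ) → Graph (Fin (m + 1))
wheel m = join (cycle m) (complete 1)

-- The second component is a proof of an equation in ℕ, hence unique, so two
-- elements are equal exactly when the underlying subsets are.
TwoSubset : ℕ → Set
TwoSubset n = Σ[ A ∈ Subset n ] ∣ A ∣ ≡ 2

_△_ : ∀ {n} → Subset n → Subset n → Subset n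
A △ B = (A ─ B) ∪ (B ─ A)

△-comm : ∀ {n} (A B : Subset n) → A △ B ≡ B △ A
△-comm A B = ∪-comm (A ─ B) (B ─ A)

△-self : ∀ {n} (A : Subset n) → A △ A ≡ Subset.⊥
△-self []          = refl
△-self (true ∷ A)  = cong (false ∷_) (△-self A)
△-self (false ∷ A) = cong (false ∷_) (△-self A)

doubleVertexGraph : ∀ {n} → Graph (Fin n) → Graph (TwoSubset n)
doubleVertexGraph G ._~_ (A , _) (B , _) =
  ∃[ u ] ∃[ v ] (G ._~_ u v × A △ B ≡ ⁅ u ⁆ ∪ ⁅ v ⁆)
doubleVertexGraph G .symm {A , _} {B , _} (u , v , uv , eq) =
  u , v , uv , trans (△-comm B A) eq
doubleVertexGraph G .irrefl {A , _} (u , v , uv , eq) =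
  ∉⊥ (subst (u Subset.∈_) (trans (sym eq) (△-self A)) (p⊆p∪q ⁅ v ⁆ (x∈⁅x⁆ u)))

module _ {V : Set} (G : Graph V) where

  -- A finite set of vertices is a duplicate-free list; its cardinality is
  -- the length of the list.
  IsIndependentSet : List V → Set
  IsIndependentSet S = Unique S × (∀ {u v} → u ∈ S → v ∈ S → ¬ G ._~_ u v)

  -- α(G) = k
  IsIndependenceNumber : ℕ → Set
  IsIndependenceNumber k =
    (∃[ S ] (IsIndependentSet S × length S ≡ k)) ×
    (∀ S → IsIndependentSet S → length S ≤ k)

{-# OPTIONS --safe #-}

-- Put k = ⌊m/2⌋.
-- Upper bound: in an independent set S, each {i, j} inside the rim is charged
-- to i and to j, and each {i, hub} twice to i.  If {i, j}, {i, j′} ∈ S then j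
-- and j′ are non-adjacent on the path C_m − i, so the numbers
-- ⌊(j − i − 1 mod m) / 2⌋ < k are distinct for the different j; and {i, hub} ∈ S
-- excludes every other pair at i, where k ≥ 2 leaves room for its two charges.
-- Hence 2 |S| ≤ m k.
-- Lower bound: the pairs {x, x + d mod m} with d odd and d < k, together with
-- the pairs {x, x + k}, x < k, when k is odd, are pairwise non-adjacent.
-- Enumerating n < ⌊mk/2⌋ as n = x + a m with d = 2a + 1 yields exactly these.

module Submission where

open import Defs
open import Data.Nat
open import Data.Nat.DivMod
open import Data.Nat.Properties
open import Data.Nat.Tactic.RingSolver using (solve-∀)
open import Data.Fin using (Fin; zero; suc; toℕ; fromℕ<; inject≤; splitAt; _↑ˡ_; _↑ʳ_; combine; remQuot)
open import Data.Fin.Patterns using (0F; 1F)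
import Data.Fin.Properties as Fin
open import Data.Fin.Subset using (Subset; ⁅_⁆; _∪_; _─_; ∣_∣; _∈_; _∉_; _⊆_; inside; outside; ⊥)
open import Data.Fin.Subset.Properties
  using (x∈⁅x⁆; x∈⁅y⁆⇒x≡y; x∈p∪q⁻; p⊆p∪q; q⊆p∪q; x∈p∧x∉q⇒x∈p─q; ∪-comm; ∪-identityˡ;
         ∪-identityʳ; ∣⁅x⁆∣≡1; ⊆-antisym; _∈?_)
open import Data.List using (List; _∷_; length; lookup; tabulate)
open import Data.List.Membership.Propositional.Properties using (∈-lookup; ∈-tabulate⁻)
open import Data.List.Properties using (length-tabulate)
import Data.List.Relation.Unary.All as All
open import Data.List.Relation.Unary.AllPairs using (_∷_)
open import Data.List.Relation.Unary.Unique.Propositional using (Unique)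
open import Data.List.Relation.Unary.Unique.Propositional.Properties using (tabulate⁺)
open import Data.Product using (∃-syntax; _×_; _,_; proj₁; proj₂; map₂; swap; uncurry)
open import Data.Sum using (_⊎_; inj₁; inj₂)
import Data.Sum as Sum
open import Data.Unit using (tt)
open import Data.Vec using ([]; _∷_; here; there)
open import Function using (_∘_)
open import Relation.Nullary using (¬_; yes; no; contradiction)
open import Relation.Binary.PropositionalEquality

open Graph

-- Two-element subsets

private variable
  n : ℕ
  x y x′ y′ u v i z : Fin n

SamePair : {A : Set} → A → A → A → A → Set
SamePair x y u v = (x ≡ u × y ≡ v) ⊎ (x ≡ v × y ≡ u)

SamePair-map : {A B : Set} (f : A → B) {x y u v : A} → SamePair x y u v → SamePair (f x) (f y) (f u) (f v)
SamePair-map f (inj₁ (p , q)) = inj₁ (cong f p , cong f q)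
SamePair-map f (inj₂ (p , q)) = inj₂ (cong f p , cong f q)

∈-pair⁻ : z ∈ ⁅ x ⁆ ∪ ⁅ y ⁆ → z ≡ x ⊎ z ≡ y
∈-pair⁻ {x = x} {y} = Sum.map (x∈⁅y⁆⇒x≡y x) (x∈⁅y⁆⇒x≡y y) ∘ x∈p∪q⁻ ⁅ x ⁆ ⁅ y ⁆

∈-pairˡ : (x y : Fin n) → x ∈ ⁅ x ⁆ ∪ ⁅ y ⁆
∈-pairˡ x y = p⊆p∪q ⁅ y ⁆ (x∈⁅x⁆ x)

∈-pairʳ : (x y : Fin n) → y ∈ ⁅ x ⁆ ∪ ⁅ y ⁆
∈-pairʳ x y = q⊆p∪q ⁅ x ⁆ ⁅ y ⁆ (x∈⁅x⁆ y)

∉-pair : z ≢ x → z ≢ y → z ∉ ⁅ x ⁆ ∪ ⁅ y ⁆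
∉-pair z≢x z≢y = Sum.[ z≢x , z≢y ] ∘ ∈-pair⁻

∣pair∣≡2 : x ≢ y → ∣ ⁅ x ⁆ ∪ ⁅ y ⁆ ∣ ≡ 2
∣pair∣≡2 {x = zero}  {zero}  x≢y = contradiction refl x≢y
∣pair∣≡2 {x = zero}  {suc y} x≢y = cong ℕ.suc (trans (cong ∣_∣ (∪-identityˡ ⁅ y ⁆)) (∣⁅x⁆∣≡1 y))
∣pair∣≡2 {x = suc x} {zero}  x≢y = cong ℕ.suc (trans (cong ∣_∣ (∪-identityʳ ⁅ x ⁆)) (∣⁅x⁆∣≡1 x))
∣pair∣≡2 {x = suc x} {suc y} x≢y = ∣pair∣≡2 (x≢y ∘ cong suc)

∣p∣≡0⇒p≡⊥ : (p : Subset n) → ∣ p ∣ ≡ 0 → p ≡ ⊥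
∣p∣≡0⇒p≡⊥ []            _  = refl
∣p∣≡0⇒p≡⊥ (outside ∷ p) eq = cong (outside ∷_) (∣p∣≡0⇒p≡⊥ p eq)

∣p∣≡1⇒p≡⁅x⁆ : (p : Subset n) → ∣ p ∣ ≡ 1 → ∃[ x ] p ≡ ⁅ x ⁆
∣p∣≡1⇒p≡⁅x⁆ (inside ∷ p)  eq = zero , cong (inside ∷_) (∣p∣≡0⇒p≡⊥ p (suc-injective eq))
∣p∣≡1⇒p≡⁅x⁆ (outside ∷ p) eq with ∣p∣≡1⇒p≡⁅x⁆ p eq
... | x , refl = suc x , refl

∣p∣≡2⇒p≡pair : (p : Subset n) → ∣ p ∣ ≡ 2 → ∃[ x ] ∃[ y ] (x ≢ y × p ≡ ⁅ x ⁆ ∪ ⁅ y ⁆)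
∣p∣≡2⇒p≡pair (inside ∷ p) eq with ∣p∣≡1⇒p≡⁅x⁆ p (suc-injective eq)
... | y , refl = zero , suc y , (λ ()) , cong (inside ∷_) (sym (∪-identityˡ ⁅ y ⁆))
∣p∣≡2⇒p≡pair (outside ∷ p) eq with ∣p∣≡2⇒p≡pair p eq
... | x , y , x≢y , refl = suc x , suc y , (λ { refl → x≢y refl }) , refl

∈-△⁻ : (A B : Subset n) → z ∈ A △ B → (z ∈ A × z ∉ B) ⊎ (z ∈ B × z ∉ A)
∈-△⁻ A B z∈ = Sum.map (∈-─⁻ A B) (∈-─⁻ B A) (x∈p∪q⁻ (A ─ B) (B ─ A) z∈)
  where
  ∈-─⁻ : ∀ {n} {z : Fin n} (A B : Subset n) → z ∈ A ─ B → z ∈ A × z ∉ B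
  ∈-─⁻ (inside ∷ A) (outside ∷ B) here = here , λ ()
  ∈-─⁻ (_ ∷ A) (inside ∷ B) (there z∈) with ∈-─⁻ A B z∈
  ... | z∈A , z∉B = there z∈A , λ { (there z∈B) → z∉B z∈B }
  ∈-─⁻ (_ ∷ A) (outside ∷ B) (there z∈) with ∈-─⁻ A B z∈
  ... | z∈A , z∉B = there z∈A , λ { (there z∈B) → z∉B z∈B }

∈-△⁺ˡ : {A B : Subset n} → z ∈ A → z ∉ B → z ∈ A △ B
∈-△⁺ˡ {A = A} {B} z∈A z∉B = p⊆p∪q (B ─ A) (x∈p∧x∉q⇒x∈p─q z∈A z∉B)

∈-△⁺ʳ : {A B : Subset n} → z ∈ B → z ∉ A → z ∈ A △ B
∈-△⁺ʳ {A = A} {B} z∈B z∉A = q⊆p∪q (A ─ B) (B ─ A) (x∈p∧x∉q⇒x∈p─q z∈B z∉A)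

pair-△-pair : i ≢ u → i ≢ v → u ≢ v →
  (⁅ i ⁆ ∪ ⁅ u ⁆) △ (⁅ i ⁆ ∪ ⁅ v ⁆) ≡ ⁅ u ⁆ ∪ ⁅ v ⁆
pair-△-pair {i = i} {u} {v} i≢u i≢v u≢v = ⊆-antisym to from
  where
  P Q : Subset _
  P = ⁅ i ⁆ ∪ ⁅ u ⁆
  Q = ⁅ i ⁆ ∪ ⁅ v ⁆
  to : P △ Q ⊆ ⁅ u ⁆ ∪ ⁅ v ⁆
  to z∈ with ∈-△⁻ P Q z∈
  ... | inj₁ (z∈P , z∉Q) with ∈-pair⁻ z∈P
  ...   | inj₁ refl = contradiction (∈-pairˡ i v) z∉Q
  ...   | inj₂ refl = ∈-pairˡ u v
  to z∈ | inj₂ (z∈Q , z∉P) with ∈-pair⁻ z∈Q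
  ...   | inj₁ refl = contradiction (∈-pairˡ i u) z∉P
  ...   | inj₂ refl = ∈-pairʳ u v
  from : ⁅ u ⁆ ∪ ⁅ v ⁆ ⊆ P △ Q
  from z∈ with ∈-pair⁻ z∈
  ... | inj₁ refl = ∈-△⁺ˡ (∈-pairʳ i u) (∉-pair (≢-sym i≢u) u≢v)
  ... | inj₂ refl = ∈-△⁺ʳ (∈-pairʳ i v) (∉-pair (≢-sym i≢v) (≢-sym u≢v))

SamePair-∈ : u ∈ ⁅ x ⁆ ∪ ⁅ y ⁆ → v ∈ ⁅ x ⁆ ∪ ⁅ y ⁆ → u ≢ v → SamePair x y u v
SamePair-∈ u∈ v∈ u≢v with ∈-pair⁻ u∈ | ∈-pair⁻ v∈
... | inj₁ refl | inj₁ refl = contradiction refl u≢v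
... | inj₁ refl | inj₂ refl = inj₁ (refl , refl)
... | inj₂ refl | inj₁ refl = inj₂ (refl , refl)
... | inj₂ refl | inj₂ refl = contradiction refl u≢v

pair-injective : x ≢ y → ⁅ x ⁆ ∪ ⁅ y ⁆ ≡ ⁅ u ⁆ ∪ ⁅ v ⁆ → SamePair u v x y
pair-injective {x = x} {y} x≢y eq =
  SamePair-∈ (subst (x ∈_) eq (∈-pairˡ x y)) (subst (y ∈_) eq (∈-pairʳ x y)) x≢y

other : u ∈ ⁅ x ⁆ ∪ ⁅ y ⁆ → x ≢ y → ∃[ i ] (i ≢ u × i ∈ ⁅ x ⁆ ∪ ⁅ y ⁆)
other {x = x} {y} u∈ x≢y with ∈-pair⁻ u∈
... | inj₁ refl = y , ≢-sym x≢y , ∈-pairʳ x y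
... | inj₂ refl = x , x≢y , ∈-pairˡ x y

-- The first pair can only be {u, v}, so the second is disjoint from it and `x′` survives in the
-- symmetric difference, although `x′` is neither u nor v.
⊈-△-pair : u ≢ v → u ∈ ⁅ x ⁆ ∪ ⁅ y ⁆ → v ∈ ⁅ x ⁆ ∪ ⁅ y ⁆ →
  u ∉ ⁅ x′ ⁆ ∪ ⁅ y′ ⁆ → v ∉ ⁅ x′ ⁆ ∪ ⁅ y′ ⁆ →
  (⁅ x ⁆ ∪ ⁅ y ⁆) △ (⁅ x′ ⁆ ∪ ⁅ y′ ⁆) ≢ ⁅ u ⁆ ∪ ⁅ v ⁆
⊈-△-pair {u = u} {v} {x} {y} {x′} {y′} u≢v u∈P v∈P u∉Q v∉Q eq =
  ∉-pair x′≢u x′≢v (subst (x′ ∈_) eq (∈-△⁺ʳ (∈-pairˡ x′ y′) x′∉P))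
  where
  x′≢u : x′ ≢ u
  x′≢u refl = u∉Q (∈-pairˡ x′ y′)
  x′≢v : x′ ≢ v
  x′≢v refl = v∉Q (∈-pairˡ x′ y′)
  x′∉P : x′ ∉ ⁅ x ⁆ ∪ ⁅ y ⁆
  x′∉P with SamePair-∈ u∈P v∈P u≢v
  ... | inj₁ (refl , refl) = ∉-pair x′≢u x′≢v
  ... | inj₂ (refl , refl) = ∉-pair x′≢v x′≢u

-- The partner i of u in the first pair is neither u nor v, so it must cancel in the symmetric
-- difference and hence lies in the second pair too.
△-pair-split : x ≢ y → u ∈ ⁅ x ⁆ ∪ ⁅ y ⁆ → u ∉ ⁅ x′ ⁆ ∪ ⁅ y′ ⁆ →
  v ∈ ⁅ x′ ⁆ ∪ ⁅ y′ ⁆ → v ∉ ⁅ x ⁆ ∪ ⁅ y ⁆ →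
  (⁅ x ⁆ ∪ ⁅ y ⁆) △ (⁅ x′ ⁆ ∪ ⁅ y′ ⁆) ≡ ⁅ u ⁆ ∪ ⁅ v ⁆ →
  ∃[ i ] (SamePair x y i u × SamePair x′ y′ i v)
△-pair-split {x = x} {y} {u} {x′} {y′} {v} x≢y u∈P u∉Q v∈Q v∉P eq with other u∈P x≢y
... | i , i≢u , i∈P = i , SamePair-∈ i∈P u∈P i≢u , SamePair-∈ i∈Q v∈Q i≢v
  where
  i≢v : i ≢ v
  i≢v refl = v∉P i∈P
  i∈Q : i ∈ ⁅ x′ ⁆ ∪ ⁅ y′ ⁆
  i∈Q with i ∈? (⁅ x′ ⁆ ∪ ⁅ y′ ⁆)
  ... | yes i∈Q = i∈Q
  ... | no  i∉Q = contradiction (subst (i ∈_) eq (∈-△⁺ˡ i∈P i∉Q)) (∉-pair i≢u i≢v)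

-- Split by which pair contains u and which contains v. Both in the same pair is impossible;
-- otherwise the two pairs share i. Non-adjacency thus has to be checked only for pairs with a
-- common vertex.
△-pair⁻ : x ≢ y → x′ ≢ y′ → u ≢ v → (⁅ x ⁆ ∪ ⁅ y ⁆) △ (⁅ x′ ⁆ ∪ ⁅ y′ ⁆) ≡ ⁅ u ⁆ ∪ ⁅ v ⁆ →
  ∃[ i ] ((SamePair x y i u × SamePair x′ y′ i v) ⊎ (SamePair x y i v × SamePair x′ y′ i u))
△-pair⁻ {n} {x} {y} {x′} {y′} {u} {v} x≢y x′≢y′ u≢v eq
  with ∈-△⁻ P Q (subst (u ∈_) (sym eq) (∈-pairˡ u v))
     | ∈-△⁻ P Q (subst (v ∈_) (sym eq) (∈-pairʳ u v))
  where
  P Q : Subset n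
  P = ⁅ x ⁆ ∪ ⁅ y ⁆
  Q = ⁅ x′ ⁆ ∪ ⁅ y′ ⁆
... | inj₁ (u∈P , u∉Q) | inj₁ (v∈P , v∉Q) =
  contradiction eq (⊈-△-pair u≢v u∈P v∈P u∉Q v∉Q)
... | inj₁ (u∈P , u∉Q) | inj₂ (v∈Q , v∉P) =
  map₂ inj₁ (△-pair-split x≢y u∈P u∉Q v∈Q v∉P eq)
... | inj₂ (u∈Q , u∉P) | inj₁ (v∈P , v∉Q) =
  map₂ (inj₂ ∘ swap) (△-pair-split x′≢y′ u∈Q u∉P v∈P v∉Q (trans (△-comm _ _) eq))
... | inj₂ (u∈Q , u∉P) | inj₂ (v∈Q , v∉P) =
  contradiction (trans (△-comm _ _) eq) (⊈-△-pair u≢v u∈Q v∈Q u∉P v∉P)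

-- Counting by injections

lookup-injective : {A : Set} {xs : List A} → Unique xs → ∀ i j → lookup xs i ≡ lookup xs j → i ≡ j
lookup-injective (_ ∷ _) zero zero _ = refl
lookup-injective (x∉ ∷ _) zero (suc j) eq = contradiction eq (All.lookup x∉ (∈-lookup j))
lookup-injective (x∉ ∷ _) (suc i) zero eq = contradiction (sym eq) (All.lookup x∉ (∈-lookup i))
lookup-injective (_ ∷ u) (suc i) (suc j) eq = cong suc (lookup-injective u i j eq)

-- The pigeonhole principle, carried along the bijection between `Fin a × Fin b` and `Fin (a * b)`.
-- It turns an injective charging into 2 |S| ≤ m k.
×-injective⇒≤ : ∀ {a b c d} (f : Fin a × Fin b → Fin c × Fin d) →
  (∀ p q → f p ≡ f q → p ≡ q) → a * b ≤ c * d
×-injective⇒≤ {a} {b} f f-injective = Fin.injective⇒≤ {f = uncurry combine ∘ f ∘ remQuot b} λ {x} {y} eq →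
  let p , q = Fin.combine-injective _ _ _ _ eq
  in begin
    x                            ≡⟨ Fin.combine-remQuot {a} b x ⟨
    uncurry combine (remQuot {a} b x)  ≡⟨ cong (uncurry combine) (f-injective _ _ (cong₂ _,_ p q)) ⟩
    uncurry combine (remQuot {a} b y)  ≡⟨ Fin.combine-remQuot {a} b y ⟩
    y                            ∎
  where open ≡-Reasoning

-- Arithmetic modulo m and the cycle

module _ (m : ℕ) .{{_ : NonZero m}} where

  step-step : ∀ x a b → ((x + a) % m + b) % m ≡ (x + (a + b)) % m
  step-step x a b = begin
    ((x + a) % m + b) % m           ≡⟨ %-distribˡ-+ ((x + a) % m) b m ⟩
    ((x + a) % m % m + b % m) % m   ≡⟨ cong (λ t → (t + b % m) % m) (m%n%n≡m%n (x + a) m) ⟩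
    ((x + a) % m + b % m) % m       ≡⟨ %-distribˡ-+ (x + a) b m ⟨
    (x + a + b) % m                 ≡⟨ cong (_% m) (+-assoc x a b) ⟩
    (x + (a + b)) % m               ∎
    where open ≡-Reasoning

  %-cancelˡ-+ : ∀ x a b → (x + a) % m ≡ (x + b) % m → a % m ≡ b % m
  %-cancelˡ-+ x a b eq = begin
    a % m                     ≡⟨ back a ⟨
    ((x + a) % m + c) % m     ≡⟨ cong (λ t → (t + c) % m) eq ⟩
    ((x + b) % m + c) % m     ≡⟨ back b ⟩
    b % m                     ∎
    where
    open ≡-Reasoning
    -- This is -x modulo m, since x + c = x m.
    c = x * pred m
    back : ∀ a → ((x + a) % m + c) % m ≡ a % m
    back a = begin
      ((x + a) % m + c) % m   ≡⟨ step-step x a c ⟩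
      (x + (a + c)) % m       ≡⟨ cong (_% m) (+-assoc x a c) ⟨
      (x + a + c) % m         ≡⟨ cong (λ t → (t + c) % m) (+-comm x a) ⟩
      (a + x + c) % m         ≡⟨ cong (_% m) (+-assoc a x c) ⟩
      (a + (x + c)) % m       ≡⟨ cong (λ t → (a + t) % m) (*-suc x (pred m)) ⟨
      (a + x * suc (pred m)) % m ≡⟨ cong (λ t → (a + x * t) % m) (suc-pred m) ⟩
      (a + x * m) % m         ≡⟨ [m+kn]%n≡m%n a x m ⟩
      a % m                   ∎

  -- j − i − 1 modulo m, i.e. the position of j on the path C_m − i.
  gap : Fin m → Fin m → ℕ
  gap i j = (toℕ j + (m ∸ suc (toℕ i))) % m

  step-gap : ∀ i j → (toℕ i + suc (gap i j)) % m ≡ toℕ j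
  step-gap i j = begin
    (toℕ i + suc (gap i j)) % m                ≡⟨ cong (_% m) (trans (+-suc (toℕ i) _) (+-comm (suc (toℕ i)) _)) ⟩
    (gap i j + suc (toℕ i)) % m                ≡⟨ step-step (toℕ j) (m ∸ suc (toℕ i)) (suc (toℕ i)) ⟩
    (toℕ j + (m ∸ suc (toℕ i) + suc (toℕ i))) % m  ≡⟨ cong (λ t → (toℕ j + t) % m) (m∸n+n≡m (Fin.toℕ<n i)) ⟩
    (toℕ j + m) % m                            ≡⟨ [m+n]%n≡m%n (toℕ j) m ⟩
    toℕ j % m                                  ≡⟨ m<n⇒m%n≡m (Fin.toℕ<n j) ⟩
    toℕ j                                      ∎
    where open ≡-Reasoning

  gap-injective : ∀ i {j j′} → gap i j ≡ gap i j′ → j ≡ j′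
  gap-injective i {j} {j′} eq = Fin.toℕ-injective (begin
    toℕ j                         ≡⟨ step-gap i j ⟨
    (toℕ i + suc (gap i j)) % m   ≡⟨ cong (λ g → (toℕ i + suc g) % m) eq ⟩
    (toℕ i + suc (gap i j′)) % m  ≡⟨ step-gap i j′ ⟩
    toℕ j′                        ∎)
    where open ≡-Reasoning

  -- The value m would make `step-gap` a full turn around the cycle, forcing i = j.
  1+gap<m : ∀ {i j} → i ≢ j → suc (gap i j) < m
  1+gap<m {i} {j} i≢j = ≤∧≢⇒< (m%n<n (toℕ j + (m ∸ suc (toℕ i))) m) λ eq → i≢j (Fin.toℕ-injective (begin
    toℕ i                        ≡⟨ m<n⇒m%n≡m (Fin.toℕ<n i) ⟨
    toℕ i % m                    ≡⟨ [m+n]%n≡m%n (toℕ i) m ⟨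
    (toℕ i + m) % m              ≡⟨ cong (λ g → (toℕ i + g) % m) eq ⟨
    (toℕ i + suc (gap i j)) % m  ≡⟨ step-gap i j ⟩
    toℕ j                        ∎))
    where open ≡-Reasoning

  Next-intro : ∀ {i j : Fin m} → toℕ j ≡ suc (toℕ i) % m → Next i j
  Next-intro {i} {j} eq with suc (toℕ i) ≟ m
  ... | yes p = inj₂ (p , trans eq (trans (cong (_% m) p) (n%n≡0 m)))
  ... | no ¬p = inj₁ (trans eq (m<n⇒m%n≡m (≤∧≢⇒< (Fin.toℕ<n i) ¬p)))

  Next-elim : ∀ {i j : Fin m} → Next i j → toℕ j ≡ suc (toℕ i) % m
  Next-elim {i} {j} (inj₁ eq) =
    trans eq (sym (m<n⇒m%n≡m (subst (_< m) eq (Fin.toℕ<n j))))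
  Next-elim (inj₂ (p , eq)) = trans eq (sym (trans (cong (_% m) p) (n%n≡0 m)))

  Next-gap : ∀ i {j j′} → gap i j′ ≡ suc (gap i j) → Next j j′
  Next-gap i {j} {j′} eq = Next-intro (begin
    toℕ j′                                 ≡⟨ step-gap i j′ ⟨
    (toℕ i + suc (gap i j′)) % m           ≡⟨ cong (λ g → (toℕ i + suc g) % m) (trans eq (+-comm 1 (gap i j))) ⟩
    (toℕ i + (suc (gap i j) + 1)) % m      ≡⟨ step-step (toℕ i) (suc (gap i j)) 1 ⟨
    ((toℕ i + suc (gap i j)) % m + 1) % m  ≡⟨ cong (λ t → (t + 1) % m) (step-gap i j) ⟩
    (toℕ j + 1) % m                        ≡⟨ cong (_% m) (+-comm (toℕ j) 1) ⟩
    suc (toℕ j) % m                        ∎)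
    where open ≡-Reasoning

-- Halving

n≤1+[n/2]*2 : ∀ n → n ≤ suc (n / 2 * 2)
n≤1+[n/2]*2 n = begin
  n                    ≡⟨ m≡m%n+[m/n]*n n 2 ⟩
  n % 2 + n / 2 * 2    ≤⟨ +-monoˡ-≤ (n / 2 * 2) (s≤s⁻¹ (m%n<n n 2)) ⟩
  suc (n / 2 * 2)      ∎
  where open ≤-Reasoning

[n/2]*2≤n : ∀ n → n / 2 * 2 ≤ n
[n/2]*2≤n n = m/n*n≤m n 2

-- With common half q, both numbers lie in {2q, 2q + 1}: b ≤ 2q + 1 ≤ a + 1.
/2-≡⇒≡∨suc : ∀ a b → a / 2 ≡ b / 2 → a ≤ b → a ≡ b ⊎ b ≡ suc a
/2-≡⇒≡∨suc a b eq a≤b with a ≟ b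
... | yes a≡b = inj₁ a≡b
... | no  a≢b = inj₂ (≤-antisym
  (≤-trans (n≤1+[n/2]*2 b) (s≤s (subst (λ t → t * 2 ≤ a) eq ([n/2]*2≤n a))))
  (≤∧≢⇒< a≤b a≢b))

-- Vertices and edges of the wheel

module _ (m : ℕ) where

  rim : Fin m → Fin (m + 1)
  rim i = i ↑ˡ 1

  hub : Fin (m + 1)
  hub = m ↑ʳ zero

  rim-or-hub : ∀ v → (∃[ i ] v ≡ rim i) ⊎ v ≡ hub
  rim-or-hub v with splitAt m v in eq
  ... | inj₁ i = inj₁ (i , sym (Fin.splitAt⁻¹-↑ˡ eq))
  ... | inj₂ zero = inj₂ (sym (Fin.splitAt⁻¹-↑ʳ eq))

  rim-injective : ∀ {i j} → rim i ≡ rim j → i ≡ j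
  rim-injective = Fin.↑ˡ-injective 1 _ _

  rim≢hub : ∀ {i} → rim i ≢ hub
  rim≢hub {i} eq with trans (sym (Fin.splitAt-↑ˡ m i 1)) (trans (cong (splitAt m) eq) (Fin.splitAt-↑ʳ m 1 zero))
  ... | ()

  rim~rim : ∀ {i j} → cycle m ._~_ i j → wheel m ._~_ (rim i) (rim j)
  rim~rim {i} {j} i~j rewrite Fin.splitAt-↑ˡ m i 1 | Fin.splitAt-↑ˡ m j 1 = i~j

  rim~rim⁻ : ∀ {i j} → wheel m ._~_ (rim i) (rim j) → cycle m ._~_ i j
  rim~rim⁻ {i} {j} i~j rewrite Fin.splitAt-↑ˡ m i 1 | Fin.splitAt-↑ˡ m j 1 = i~j

  rim~hub : ∀ {i} → wheel m ._~_ (rim i) hub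
  rim~hub {i} rewrite Fin.splitAt-↑ˡ m i 1 | Fin.splitAt-↑ʳ m 1 zero = tt

-- Pairs with a common vertex, and the slots they occupy

TwoSubset-≡ : ∀ {n} {A B : TwoSubset n} → proj₁ A ≡ proj₁ B → A ≡ B
TwoSubset-≡ {A = A , p} {B = .A , q} refl = cong (A ,_) (≡-irrelevant p q)

doubleVertexGraph-~ : ∀ {n} (G : Graph (Fin n)) (A B : TwoSubset n) {i u v : Fin n} →
  proj₁ A ≡ ⁅ i ⁆ ∪ ⁅ u ⁆ → proj₁ B ≡ ⁅ i ⁆ ∪ ⁅ v ⁆ → i ≢ u → i ≢ v → G ._~_ u v →
  doubleVertexGraph G ._~_ A B
doubleVertexGraph-~ G (_ , _) (_ , _) {u = u} {v} refl refl i≢u i≢v u~v =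
  u , v , u~v , pair-△-pair i≢u i≢v (λ { refl → G .irrefl u~v })

-- The charging as a relation, independent of the order in which a pair is written. A spoke may
-- occupy any slot s, because it conflicts with every other pair at i whatever the slot.
data Occupies (m : ℕ) .{{_ : NonZero m}} (A : TwoSubset (m + 1)) (i : Fin m) (s : ℕ) : Set where
  spoke : proj₁ A ≡ ⁅ rim m i ⁆ ∪ ⁅ hub m ⁆ → Occupies m A i s
  chord : ∀ j → i ≢ j → proj₁ A ≡ ⁅ rim m i ⁆ ∪ ⁅ rim m j ⁆ → gap m i j / 2 ≡ s → Occupies m A i s

-- Upper bound by charging

module UpperBound (m : ℕ) (4≤m : 4 ≤ m) where

  instance
    m≢0 : NonZero m
    m≢0 = >-nonZero (≤-trans (s≤s z≤n) 4≤m)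

  private
    k : ℕ
    k = m / 2
    _~²_ : TwoSubset (m + 1) → TwoSubset (m + 1) → Set
    _~²_ = doubleVertexGraph (wheel m) ._~_

  -- The last position on the path is m - 2, which is at most 2k - 1.
  slot<k : ∀ {i j} → i ≢ j → gap m i j / 2 < k
  slot<k i≢j = m<n*o⇒m/o<n (s≤s⁻¹ (≤-trans (1+gap<m m i≢j) (n≤1+[n/2]*2 m)))

  slot : ∀ {i j} → i ≢ j → Fin k
  slot i≢j = fromℕ< (slot<k i≢j)

  bit : Fin 2 → Fin k
  bit b = inject≤ b (/-monoˡ-≤ 2 4≤m)

  decompose : ∀ (A : TwoSubset (m + 1)) →
    (∃[ i ] proj₁ A ≡ ⁅ rim m i ⁆ ∪ ⁅ hub m ⁆) ⊎
    (∃[ i ] ∃[ j ] (i ≢ j × proj₁ A ≡ ⁅ rim m i ⁆ ∪ ⁅ rim m j ⁆))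
  decompose (A , ∣A∣≡2) with ∣p∣≡2⇒p≡pair A ∣A∣≡2
  ... | x , y , x≢y , A≡ with rim-or-hub m x | rim-or-hub m y
  ... | inj₁ (i , refl) | inj₁ (j , refl) = inj₂ (i , j , x≢y ∘ cong (rim m) , A≡)
  ... | inj₁ (i , refl) | inj₂ refl = inj₁ (i , A≡)
  ... | inj₂ refl | inj₁ (j , refl) = inj₁ (j , trans A≡ (∪-comm _ _))
  ... | inj₂ refl | inj₂ refl = contradiction refl x≢y

  -- A charge is a vertex i of the rim together with one of the k slots at i.
  token : TwoSubset (m + 1) → Fin 2 → Fin m × Fin k
  token A b with decompose A
  token A b  | inj₁ (i , _) = i , bit b
  token A 0F | inj₂ (i , j , i≢j , _) = i , slot i≢j
  token A 1F | inj₂ (i , j , i≢j , _) = j , slot (≢-sym i≢j)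

  token-occupies : ∀ A b → Occupies m A (proj₁ (token A b)) (toℕ (proj₂ (token A b)))
  token-occupies A b with decompose A
  token-occupies A b  | inj₁ (i , A≡) = spoke A≡
  token-occupies A 0F | inj₂ (i , j , i≢j , A≡) =
    chord j i≢j A≡ (sym (Fin.toℕ-fromℕ< (slot<k i≢j)))
  token-occupies A 1F | inj₂ (i , j , i≢j , A≡) =
    chord i (≢-sym i≢j) (trans A≡ (∪-comm _ _)) (sym (Fin.toℕ-fromℕ< (slot<k (≢-sym i≢j))))

  -- The two charges of a spoke differ in their slot, those of a chord in their rim vertex.
  token-injectiveʳ : ∀ A b c → token A b ≡ token A c → b ≡ c
  token-injectiveʳ A b c eq with decompose A
  token-injectiveʳ A b  c  eq | inj₁ _ = Fin.inject≤-injective _ _ b c (cong proj₂ eq)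
  token-injectiveʳ A 0F 0F eq | inj₂ _ = refl
  token-injectiveʳ A 0F 1F eq | inj₂ (i , j , i≢j , _) = contradiction (cong proj₁ eq) i≢j
  token-injectiveʳ A 1F 0F eq | inj₂ (i , j , i≢j , _) = contradiction (sym (cong proj₁ eq)) i≢j
  token-injectiveʳ A 1F 1F eq | inj₂ _ = refl

  Next⇒~ : ∀ {i j} → Next i j → cycle m ._~_ i j
  Next⇒~ n = Next⇒≢ n , inj₁ n
    where
    Next⇒≢ : ∀ {i j : Fin m} → Next i j → i ≢ j
    Next⇒≢ (inj₁ p) refl = 1+n≢n (sym p)
    -- Wrapping around from i to itself would force m = 1.
    Next⇒≢ (inj₂ (p , q)) refl =
      contradiction (subst (4 ≤_) (trans (sym p) (cong suc q)) 4≤m) λ { (s≤s ()) }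

  chords~ : ∀ A B {i j j′} → i ≢ j → i ≢ j′ →
    proj₁ A ≡ ⁅ rim m i ⁆ ∪ ⁅ rim m j ⁆ → proj₁ B ≡ ⁅ rim m i ⁆ ∪ ⁅ rim m j′ ⁆ →
    cycle m ._~_ j j′ → A ~² B
  chords~ A B i≢j i≢j′ A≡ B≡ j~j′ = doubleVertexGraph-~ (wheel m) A B A≡ B≡
    (i≢j ∘ rim-injective m) (i≢j′ ∘ rim-injective m) (rim~rim m j~j′)

  -- Equal halves leave two cases: equal gaps give the same pair, consecutive gaps give neighbours j
  -- and j′ on the cycle.
  chords-near : ∀ A B {i j j′} → i ≢ j → i ≢ j′ →
    proj₁ A ≡ ⁅ rim m i ⁆ ∪ ⁅ rim m j ⁆ → proj₁ B ≡ ⁅ rim m i ⁆ ∪ ⁅ rim m j′ ⁆ →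
    gap m i j / 2 ≡ gap m i j′ / 2 → gap m i j ≤ gap m i j′ → A ≡ B ⊎ A ~² B
  chords-near A B {i} i≢j i≢j′ A≡ B≡ eq g≤g′ with /2-≡⇒≡∨suc _ _ eq g≤g′
  ... | inj₂ g′≡1+g = inj₂ (chords~ A B i≢j i≢j′ A≡ B≡ (Next⇒~ (Next-gap m i g′≡1+g)))
  ... | inj₁ g≡g′ with refl ← gap-injective m i g≡g′ = inj₁ (TwoSubset-≡ (trans A≡ (sym B≡)))

  -- The hub is adjacent to every rim vertex, which settles a spoke against a chord; two chords are
  -- compared by their gaps. Consequently an independent set never charges one slot from two
  -- different members.
  occupies-clash : ∀ {A B i s} → Occupies m A i s → Occupies m B i s →
    A ≡ B ⊎ (A ~² B ⊎ B ~² A)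
  occupies-clash (spoke A≡) (spoke B≡) = inj₁ (TwoSubset-≡ (trans A≡ (sym B≡)))
  occupies-clash {A} {B} (spoke A≡) (chord j i≢j B≡ _) = inj₂ (inj₂
    (doubleVertexGraph-~ (wheel m) B A B≡ A≡ (i≢j ∘ rim-injective m) (rim≢hub m) (rim~hub m)))
  occupies-clash {A} {B} (chord j i≢j A≡ _) (spoke B≡) = inj₂ (inj₁
    (doubleVertexGraph-~ (wheel m) A B A≡ B≡ (i≢j ∘ rim-injective m) (rim≢hub m) (rim~hub m)))
  occupies-clash {A} {B} {i} (chord j i≢j A≡ p) (chord j′ i≢j′ B≡ q)
    with ≤-total (gap m i j) (gap m i j′)
  ... | inj₁ g≤g′ = Sum.map₂ inj₁ (chords-near A B i≢j i≢j′ A≡ B≡ (trans p (sym q)) g≤g′)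
  ... | inj₂ g′≤g = Sum.map sym inj₂ (chords-near B A i≢j′ i≢j B≡ A≡ (trans q (sym p)) g′≤g)

  module _ (S : List (TwoSubset (m + 1))) (indep : IsIndependentSet (doubleVertexGraph (wheel m)) S) where

    place : Fin (length S) × Fin 2 → Fin m × Fin k
    place (a , b) = token (lookup S a) b

    place-injective : ∀ p q → place p ≡ place q → p ≡ q
    place-injective (a , b) (c , d) eq
      with occupies-clash (token-occupies (lookup S a) b)
             (subst (λ t → Occupies m (lookup S c) (proj₁ t) (toℕ (proj₂ t))) (sym eq)
               (token-occupies (lookup S c) d))
    ... | inj₂ (inj₁ ac) = contradiction ac (proj₂ indep (∈-lookup a) (∈-lookup c))
    ... | inj₂ (inj₂ ca) = contradiction ca (proj₂ indep (∈-lookup c) (∈-lookup a))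
    ... | inj₁ a≡c with refl ← lookup-injective (proj₁ indep) a c a≡c =
      cong (a ,_) (token-injectiveʳ (lookup S a) b d eq)

    length*2≤m*k : length S * 2 ≤ m * k
    length*2≤m*k = ×-injective⇒≤ place place-injective

    length≤ : length S ≤ m * k / 2
    length≤ = subst (_≤ m * k / 2) (m*n/n≡m (length S) 2) (/-monoˡ-≤ 2 length*2≤m*k)

-- Lower bound: arcs of odd length

odd≢even : ∀ a b → suc (a * 2) ≢ b * 2
odd≢even (suc a) (suc b) eq = odd≢even a b (suc-injective (suc-injective eq))

0<n⇒n%m≡0%m⇒m≤n : ∀ {n m} .{{_ : NonZero m}} → 0 < n → n % m ≡ 0 % m → m ≤ n
0<n⇒n%m≡0%m⇒m≤n {n} {m} 0<n eq with m ≤? n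
... | yes m≤n = m≤n
... | no  m≰n = contradiction n≡0 (n>0⇒n≢0 0<n)
  where
  n≡0 : n ≡ 0
  n≡0 = trans (sym (m<n⇒m%n≡m (≰⇒> m≰n))) (trans eq (m<n⇒m%n≡m (>-nonZero⁻¹ m)))

module LowerBound (m : ℕ) (4≤m : 4 ≤ m) where

  instance
    m≢0 : NonZero m
    m≢0 = >-nonZero (≤-trans (s≤s z≤n) 4≤m)

  private
    k : ℕ
    k = m / 2

  k+k≤m : k + k ≤ m
  k+k≤m = subst (_≤ m) (trans (*-comm k 2) (cong (k +_) (+-identityʳ k))) ([n/2]*2≤n m)

  -- From 2 ≤ k follows 2 + k ≤ k + k ≤ m. So d and d + 1 are below m for every arc, and are
  -- determined by their residues.
  1+k<m : suc k < m
  1+k<m = ≤-trans (+-monoˡ-≤ k (/-monoˡ-≤ 2 4≤m)) k+k≤m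

  -- The ordered pair (x , x + d mod m), where d = 1 + 2 half is odd.  Layer d = k
  -- keeps only x < k, hence never wraps around.
  record Arc (x y : ℕ) : Set where
    field
      half  : ℕ
      x<m   : x < m
      y≡x+d : y ≡ (x + suc (half * 2)) % m
      d≤k   : suc (half * 2) ≤ k
      d≡k⇒x<k : suc (half * 2) ≡ k → x < k
    d : ℕ
    d = suc (half * 2)

  open Arc

  d<m : ∀ {x y} (e : Arc x y) → d e < m
  d<m e = <-trans (s≤s (d≤k e)) 1+k<m

  d≡k⇒k≤y : ∀ {x y} (e : Arc x y) → d e ≡ k → k ≤ y
  d≡k⇒k≤y {x} {y} e d≡k = begin
    k            ≤⟨ m≤n+m k x ⟩
    x + k        ≡⟨ m<n⇒m%n≡m (≤-trans (+-monoˡ-≤ k (d≡k⇒x<k e d≡k)) k+k≤m) ⟨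
    (x + k) % m  ≡⟨ cong (λ t → (x + t) % m) d≡k ⟨
    (x + d e) % m ≡⟨ y≡x+d e ⟨
    y            ∎
    where open ≤-Reasoning

  -- Cancelling x leaves c ≡ 0 modulo m with c positive.
  round-trip : ∀ {x} c → x < m → 0 < c → x ≡ (x + c) % m → m ≤ c
  round-trip {x} c x<m 0<c eq = 0<n⇒n%m≡0%m⇒m≤n 0<c (%-cancelˡ-+ m x c 0 (begin
    (x + c) % m  ≡⟨ eq ⟨
    x            ≡⟨ m<n⇒m%n≡m x<m ⟨
    x % m        ≡⟨ cong (_% m) (+-identityʳ x) ⟨
    (x + 0) % m  ∎))
    where open ≡-Reasoning

  Arc-x≢y : ∀ {x y} → Arc x y → x ≢ y
  Arc-x≢y e refl = <⇒≱ (d<m e) (round-trip (d e) (x<m e) z<s (y≡x+d e))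

  -- The common vertex x would be below k as the tail of one arc and at least k as the head of the
  -- other.
  not-both-k : ∀ {x y u} (e : Arc x y) (f : Arc u x) → d e ≡ k → d f ≢ k
  not-both-k e f p q = <⇒≱ (d≡k⇒x<k e p) (d≡k⇒k≤y f q)

  -- The strictness comes from truncating layer k; it rules out closed walks made of two arcs even
  -- when m = 2k.
  d+d<2k : ∀ {x y u} (e : Arc x y) (f : Arc u x) → d e + d f < k + k
  d+d<2k e f with d e ≟ k
  ... | no  p = +-mono-<-≤ (≤∧≢⇒< (d≤k e) p) (d≤k f)
  ... | yes p = +-mono-≤-< (d≤k e) (≤∧≢⇒< (d≤k f) (not-both-k e f p))

  Arc-asym : ∀ {x y} → Arc x y → ¬ Arc y x
  Arc-asym {x} {y} e f = <⇒≱ (d+d<2k e f) (≤-trans k+k≤m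
    (round-trip (d e + d f) (x<m e) z<s (begin
      x                        ≡⟨ y≡x+d f ⟩
      (y + d f) % m            ≡⟨ cong (λ t → (t + d f) % m) (y≡x+d e) ⟩
      ((x + d e) % m + d f) % m ≡⟨ step-step m x (d e) (d f) ⟩
      (x + (d e + d f)) % m    ∎)))
    where open ≡-Reasoning

  -- Both sides are residues of numbers below m, the left one even and the right one odd.
  suc-d≢d : ∀ {x y u v} (e : Arc x y) (f : Arc u v) → (suc (d e)) % m ≢ d f % m
  suc-d≢d e f eq = odd≢even (half f) (suc (half e)) (begin
    d f              ≡⟨ m<n⇒m%n≡m (d<m f) ⟨
    d f % m          ≡⟨ eq ⟨
    suc (d e) % m    ≡⟨ m<n⇒m%n≡m (≤-<-trans (s≤s (d≤k e)) 1+k<m) ⟩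
    suc (d e)        ∎)
    where open ≡-Reasoning

  Arcs-out : ∀ {i u v} → Arc i u → Arc i v → v ≢ suc u % m
  Arcs-out {i} {u} {v} e f v≡1+u = suc-d≢d e f (%-cancelˡ-+ m i _ _ (begin
    (i + suc (d e)) % m       ≡⟨ cong (λ t → (i + t) % m) (+-comm 1 (d e)) ⟩
    (i + (d e + 1)) % m       ≡⟨ step-step m i (d e) 1 ⟨
    ((i + d e) % m + 1) % m   ≡⟨ cong (λ t → (t + 1) % m) (y≡x+d e) ⟨
    (u + 1) % m               ≡⟨ cong (_% m) (+-comm u 1) ⟩
    suc u % m                 ≡⟨ v≡1+u ⟨
    v                         ≡⟨ y≡x+d f ⟩
    (i + d f) % m             ∎))
    where open ≡-Reasoning

  1+u-step : ∀ u {v} c → v ≡ suc u % m → (v + c) % m ≡ (u + suc c) % m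
  1+u-step u {v} c eq = begin
    (v + c) % m           ≡⟨ cong (λ t → (t + c) % m) eq ⟩
    (suc u % m + c) % m   ≡⟨ cong (λ t → (t % m + c) % m) (+-comm 1 u) ⟩
    ((u + 1) % m + c) % m ≡⟨ step-step m u 1 c ⟩
    (u + suc c) % m       ∎
    where open ≡-Reasoning

  Arcs-in : ∀ {i u v} → Arc u i → Arc v i → v ≢ suc u % m
  Arcs-in {i} {u} {v} e f v≡1+u = suc-d≢d f e (%-cancelˡ-+ m u _ _ (begin
    (u + suc (d f)) % m       ≡⟨ 1+u-step u (d f) v≡1+u ⟨
    (v + d f) % m             ≡⟨ y≡x+d f ⟨
    i                         ≡⟨ y≡x+d e ⟩
    (u + d e) % m             ∎))
    where open ≡-Reasoning

  -- The closed walk from i to u, on to v = u + 1 and back to i has length d + 1 + d′, at least m ≥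
  -- 2k and at most 2k. So it equals 2k, but it is odd.
  Arcs-around : ∀ {i u v} → Arc i u → Arc v i → v ≢ suc u % m
  Arcs-around {i} {u} {v} e f v≡1+u = odd≢even (suc (half e + half f)) k (begin
    suc (suc (half e + half f) * 2)  ≡⟨ rearrange (half e) (half f) ⟩
    d e + suc (d f)                  ≡⟨ ≤-antisym c≤2k (≤-trans k+k≤m m≤c) ⟩
    k + k                            ≡⟨ cong (k +_) (+-identityʳ k) ⟨
    2 * k                            ≡⟨ *-comm 2 k ⟩
    k * 2                            ∎)
    where
    open ≡-Reasoning
    rearrange : ∀ a b → suc (suc (a + b) * 2) ≡ suc (a * 2) + suc (suc (b * 2))
    rearrange = solve-∀
    c≤2k : d e + suc (d f) ≤ k + k
    c≤2k = subst (_≤ k + k) (sym (+-suc (d e) (d f))) (d+d<2k e f)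
    m≤c : m ≤ d e + suc (d f)
    m≤c = round-trip _ (x<m e) z<s (begin
      i                               ≡⟨ y≡x+d f ⟩
      (v + d f) % m                   ≡⟨ 1+u-step u (d f) v≡1+u ⟩
      (u + suc (d f)) % m             ≡⟨ cong (λ t → (t + suc (d f)) % m) (y≡x+d e) ⟩
      ((i + d e) % m + suc (d f)) % m ≡⟨ step-step m i (d e) (suc (d f)) ⟩
      (i + (d e + suc (d f))) % m     ∎)

  -- Walking from u through i to v advances by d + d′, which would have to be 1 modulo m; but d + d′
  -- - 1 lies strictly between 0 and m.
  Arcs-through : ∀ {i u v} → Arc u i → Arc i v → v ≢ suc u % m
  Arcs-through {i} {u} {v} e f v≡1+u = <⇒≱ c<m (0<n⇒n%m≡0%m⇒m≤n 0<c (%-cancelˡ-+ m (suc u) c 0 (begin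
    (suc u + c) % m               ≡⟨ cong (_% m) (shift u (half e) (d f)) ⟩
    (u + (d e + d f)) % m         ≡⟨ step-step m u (d e) (d f) ⟨
    ((u + d e) % m + d f) % m     ≡⟨ cong (λ t → (t + d f) % m) (y≡x+d e) ⟨
    (i + d f) % m                 ≡⟨ y≡x+d f ⟨
    v                             ≡⟨ v≡1+u ⟩
    suc u % m                     ≡⟨ cong (_% m) (+-identityʳ (suc u)) ⟨
    (suc u + 0) % m               ∎)))
    where
    open ≡-Reasoning
    c = half e * 2 + d f
    shift : ∀ u h t → suc u + (h * 2 + t) ≡ u + (suc (h * 2) + t)
    shift = solve-∀
    0<c : 0 < c
    0<c = ≤-trans z<s (m≤n+m (d f) (half e * 2))
    c<m : c < m
    c<m = ≤-trans (+-mono-≤ (d≤k e) (d≤k f)) k+k≤m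

  -- The shared vertex i is the tail or the head of each arc, giving four cases. The other
  -- direction, u = v + 1, follows by exchanging the arcs.
  Arcs-apart : ∀ {x y x′ y′ i u v} → Arc x y → Arc x′ y′ →
    SamePair x y i u → SamePair x′ y′ i v → v ≢ suc u % m
  Arcs-apart e f (inj₁ (refl , refl)) (inj₁ (refl , refl)) = Arcs-out e f
  Arcs-apart e f (inj₁ (refl , refl)) (inj₂ (refl , refl)) = Arcs-around e f
  Arcs-apart e f (inj₂ (refl , refl)) (inj₁ (refl , refl)) = Arcs-through e f
  Arcs-apart e f (inj₂ (refl , refl)) (inj₂ (refl , refl)) = Arcs-in e f

  -- Enumeration of the arcs

  N : ℕ
  N = m * k / 2

  source target : ℕ → ℕ
  source n = n % m
  target n = (n % m + suc (n / m * 2)) % m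

  -- This is 2 (n + 1) ≤ m k with n = x + a m. It yields 2a < k, hence d ≤ k; and if d = k, it
  -- leaves 2 (x + 1) ≤ m, hence x < k.
  index-bound : ∀ {n} → n < N → (suc (n % m)) * 2 + m * (n / m * 2) ≤ m * k
  index-bound {n} n<N = begin
    suc (n % m) * 2 + m * (n / m * 2)  ≡⟨ rearrange m (n % m) (n / m) ⟩
    suc (n % m + n / m * m) * 2        ≡⟨ cong (λ t → suc t * 2) (m≡m%n+[m/n]*n n m) ⟨
    suc n * 2                          ≤⟨ *-monoˡ-≤ 2 n<N ⟩
    N * 2                              ≤⟨ [n/2]*2≤n (m * k) ⟩
    m * k                              ∎
    where
    open ≤-Reasoning
    rearrange : ∀ m x a → suc x * 2 + m * (a * 2) ≡ suc (x + a * m) * 2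
    rearrange = solve-∀

  arc : ∀ {n} → n < N → Arc (source n) (target n)
  arc {n} n<N = record
    { half    = n / m
    ; x<m     = m%n<n n m
    ; y≡x+d   = refl
    ; d≤k     = *-cancelˡ-< m _ _ (≤-trans (s≤s (m≤n+m (m * (n / m * 2)) _)) (index-bound n<N))
    ; d≡k⇒x<k = λ d≡k → subst (_≤ k) (m*n/n≡m (suc (n % m)) 2) (/-monoˡ-≤ 2
        (+-cancelʳ-≤ (m * (n / m * 2)) _ _ (begin
          suc (n % m) * 2 + m * (n / m * 2)  ≤⟨ index-bound n<N ⟩
          m * k                              ≡⟨ cong (m *_) d≡k ⟨
          m * suc (n / m * 2)                ≡⟨ *-suc m (n / m * 2) ⟩
          m + m * (n / m * 2)                ∎)))
    }
    where open ≤-Reasoning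

  -- `Arc-asym` excludes a reversed match. Otherwise the sources give n modulo m, and the targets
  -- then give d and so the quotient.
  endpoints-injective : ∀ {n n′} → n < N → n′ < N →
    SamePair (source n′) (target n′) (source n) (target n) → n ≡ n′
  endpoints-injective n<N n′<N (inj₂ (p , q)) =
    contradiction (subst₂ Arc p q (arc n′<N)) (Arc-asym (arc n<N))
  endpoints-injective {n} {n′} n<N n′<N (inj₁ (p , q)) = begin
    n                      ≡⟨ m≡m%n+[m/n]*n n m ⟩
    n % m + n / m * m      ≡⟨ cong₂ (λ x a → x + a * m) (sym p) a≡a′ ⟩
    n′ % m + n′ / m * m    ≡⟨ m≡m%n+[m/n]*n n′ m ⟨
    n′                     ∎
    where
    open ≡-Reasoning
    d≡d′ : d (arc n<N) ≡ d (arc n′<N)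
    d≡d′ = begin
      d (arc n<N)       ≡⟨ m<n⇒m%n≡m (d<m (arc n<N)) ⟨
      d (arc n<N) % m   ≡⟨ %-cancelˡ-+ m (n % m) _ _ (trans (sym q) (cong (λ t → (t + _) % m) p)) ⟩
      d (arc n′<N) % m  ≡⟨ m<n⇒m%n≡m (d<m (arc n′<N)) ⟩
      d (arc n′<N)      ∎
    a≡a′ : n / m ≡ n′ / m
    a≡a′ = *-cancelʳ-≡ _ _ 2 (suc-injective d≡d′)

  -- The arcs as an independent set of 2-subsets

  rimℕ : ∀ x → .(x < m) → Fin (m + 1)
  rimℕ x x<m = rim m (fromℕ< x<m)

  toℕ-rimℕ : ∀ x .(x<m : x < m) → toℕ (rimℕ x x<m) ≡ x
  toℕ-rimℕ x x<m = trans (Fin.toℕ-↑ˡ _ 1) (Fin.toℕ-fromℕ< x<m)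

  tail head : Fin N → Fin (m + 1)
  tail n = rimℕ (source (toℕ n)) (m%n<n (toℕ n) m)
  head n = rimℕ (target (toℕ n)) (m%n<n (source (toℕ n) + suc (toℕ n / m * 2)) m)

  SamePair-ends : ∀ n {u v} → SamePair (tail n) (head n) u v →
    SamePair (source (toℕ n)) (target (toℕ n)) (toℕ u) (toℕ v)
  SamePair-ends n sp = subst₂ (λ x y → SamePair x y _ _) (toℕ-rimℕ _ _) (toℕ-rimℕ _ _) (SamePair-map toℕ sp)

  arcᶠ : ∀ n → Arc (source (toℕ n)) (target (toℕ n))
  arcᶠ n = arc (Fin.toℕ<n n)

  tail≢head : ∀ n → tail n ≢ head n
  tail≢head n eq = Arc-x≢y (arcᶠ n) (trans (sym (toℕ-rimℕ _ _)) (trans (cong toℕ eq) (toℕ-rimℕ _ _)))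

  arcPair : Fin N → TwoSubset (m + 1)
  arcPair n = ⁅ tail n ⁆ ∪ ⁅ head n ⁆ , ∣pair∣≡2 (tail≢head n)

  arcPair-injective : ∀ {n n′} → arcPair n ≡ arcPair n′ → n ≡ n′
  arcPair-injective {n} {n′} eq = Fin.toℕ-injective (endpoints-injective (Fin.toℕ<n n) (Fin.toℕ<n n′)
    (subst₂ (SamePair _ _) (toℕ-rimℕ _ _) (toℕ-rimℕ _ _)
      (SamePair-ends n′ (pair-injective (tail≢head n) (cong proj₁ eq)))))

  -- No arc ends at the hub, so an edge between ends of arcs is an edge of the cycle.
  SamePair-rim : ∀ n {i u} → SamePair (tail n) (head n) i u → ∃[ j ] u ≡ rim m j
  SamePair-rim n (inj₁ (_ , refl)) = _ , refl
  SamePair-rim n (inj₂ (refl , _)) = _ , refl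

  rim~rim⇒suc : ∀ {i j} → wheel m ._~_ (rim m i) (rim m j) →
    toℕ (rim m j) ≡ suc (toℕ (rim m i)) % m ⊎ toℕ (rim m i) ≡ suc (toℕ (rim m j)) % m
  rim~rim⇒suc {i} {j} i~j rewrite Fin.toℕ-↑ˡ i 1 | Fin.toℕ-↑ˡ j 1 =
    Sum.map (Next-elim m) (Next-elim m) (proj₂ (rim~rim⁻ m i~j))

  shared-end-≁ : ∀ n n′ {i u v} → SamePair (tail n) (head n) i u → SamePair (tail n′) (head n′) i v →
    ¬ wheel m ._~_ u v
  shared-end-≁ n n′ p q u~v with SamePair-rim n p | SamePair-rim n′ q
  ... | _ , refl | _ , refl with rim~rim⇒suc u~v
  ...   | inj₁ eq = Arcs-apart (arcᶠ n) (arcᶠ n′) (SamePair-ends n p) (SamePair-ends n′ q) eq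
  ...   | inj₂ eq = Arcs-apart (arcᶠ n′) (arcᶠ n) (SamePair-ends n′ q) (SamePair-ends n p) eq

  arcPair-≁ : ∀ n n′ → ¬ doubleVertexGraph (wheel m) ._~_ (arcPair n) (arcPair n′)
  arcPair-≁ n n′ (u , v , u~v , eq)
    with △-pair⁻ (tail≢head n) (tail≢head n′) (λ { refl → wheel m .irrefl {u} u~v }) eq
  ... | i , inj₁ (p , q) = shared-end-≁ n n′ p q u~v
  ... | i , inj₂ (p , q) = shared-end-≁ n n′ p q (wheel m .symm {u} u~v)

  arcPairs : List (TwoSubset (m + 1))
  arcPairs = tabulate arcPair

  arcPairs-independent : IsIndependentSet (doubleVertexGraph (wheel m)) arcPairs
  arcPairs-independent = tabulate⁺ arcPair-injective , λ A∈ B∈ →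
    let (n , A≡) = ∈-tabulate⁻ A∈ ; (n′ , B≡) = ∈-tabulate⁻ B∈
    in subst₂ (λ A B → ¬ doubleVertexGraph (wheel m) ._~_ A B) (sym A≡) (sym B≡) (arcPair-≁ n n′)

theorem1p2 : (m : ℕ) → 4 ≤ m →
    IsIndependenceNumber (doubleVertexGraph (wheel m)) ((m * (m / 2)) / 2)
theorem1p2 m 4≤m =
  (arcPairs , arcPairs-independent , length-tabulate arcPair) , UpperBound.length≤ m 4≤m
  where open LowerBound m 4≤m
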